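{- There is a constant $C>0$ such that for every positive integer $n$ there is a word $w$ over $[n]$ of length at most $C n^3$ that fixes every $n$-component monotone network.
   Context: An $n$-component (Boolean) network is a function $f=(f_1,\dots,f_n):\{0,1\}^n\to\{0,1\}^n$. Write $[n]=\{1,\dots,n\}$. For $i\in[n]$ and $x\in\{0,1\}^n$, $f^i(x):=(x_1,\dots,x_{i-1},f_i(x),x_{i+1},\dots,x_n)$. For a word $w=i_1i_2\dots i_k$ over the alphabet $[n]$, $f^w:=f^{i_k}\circ\cdots\circ f^{i_1}$ (and $f^\epsilon=\mathrm{id}$ for the empty word $\epsilon$). A word $w$ fixes $f$ if $f^w(x)$ is a fixed point of $f$ for every $x\in\{0,1\}^n$. The order on $\{0,1\}^n$ is componentwise: $x\le y$ iff $x_i\le y_i$ for all $i\in[n]$. The network $f$ is monotone if $x\le y$ implies $f(x)\le f(y)$ for all $x,y$. -}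

module Defs where

open import Data.Bool.Base as Bool using (Bool)
open import Data.Fin.Base using (Fin)
open import Data.List.Base using (List; foldl)
open import Data.Nat.Base using (ℕ)
open import Data.Vec.Base using (Vec; lookup; _[_]≔_)
open import Data.Vec.Relation.Binary.Pointwise.Inductive using (Pointwise)
open import Relation.Binary.Definitions using (Monotonic₁)
open import Relation.Binary.PropositionalEquality.Core using (_≡_)

Config : ℕ → Set
Config n = Vec Bool n

Network : ℕ → Set
Network n = Config n → Config n

Word : ℕ → Set
Word n = List (Fin n)

infix 4 _≤ᶜ_

_≤ᶜ_ : ∀ {n} → Config n → Config n → Set
_≤ᶜ_ = Pointwise Bool._≤_

Monotone : ∀ {n} → Network n → Set
Monotone f = Monotonic₁ _≤ᶜ_ _≤ᶜ_ f

update : ∀ {n} → Network n → Fin n → Config n → Config n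
update f i x = x [ i ]≔ lookup (f x) i

-- The left fold applies the first letter of the word first:
-- f^(i₁ i₂ … iₖ) = f^iₖ ∘ … ∘ f^i₁.
updateWord : ∀ {n} → Network n → Word n → Config n → Config n
updateWord f w x = foldl (λ y i → update f i y) x w

IsFixedPoint : ∀ {n} → Network n → Config n → Set
IsFixedPoint f x = f x ≡ x

Fixes : ∀ {n} → Word n → Network n → Set
Fixes {n} w f = (x : Config n) → IsFixedPoint f (updateWord f w x)

{-# OPTIONS --safe #-}

-- Processing the components one at a time gives a word that is cubic.  Once a
-- word has fixed all components but one, the current configuration x and its
-- image f x differ in at most one component, so x ≤ f x or f x ≤ x.
-- For a monotone network this relation persists along updates, and from then on
-- all updates move in the same direction: a quadratic number of them, sweeping
-- repeatedly over all components, reaches a fixed point.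
module Submission where

open import Defs
open import Data.List.Base using (length)
open import Data.Nat.Base using (ℕ; _*_; _^_; _≤_; _<_)
open import Data.Product.Base using (Σ-syntax; _×_)

open import Data.Bool.Base as Bool using (Bool; true; false; not; f≤t; b≤b)
open import Data.Bool.Properties using (≤-total; ≤-isPreorder)
open import Data.Fin.Base using (Fin; zero; suc)
open import Data.List.Base using ([]; _∷_; _++_; map; concat; replicate; allFin)
open import Data.List.Membership.Propositional using (_∈_)
open import Data.List.Membership.Propositional.Properties using (∈-allFin)
open import Data.List.Properties
  using (foldl-++; length-++; length-map; length-tabulate)
open import Data.List.Relation.Unary.Any using (here; there)
open import Data.Nat.Base using (zero; suc; _+_; z≤n; s≤s)
open import Data.Nat.Properties as ℕ using (module ≤-Reasoning)
open import Data.Nat.Tactic.RingSolver using (solve-∀)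
open import Data.Product.Base using (_,_)
open import Data.Sum.Base as Sum using (_⊎_; inj₁; inj₂)
open import Data.Vec.Base as Vec using ([]; _∷_; lookup; _[_]≔_)
open import Data.Vec.Properties using ([]≔-lookup; lookup∘update)
open import Data.Vec.Relation.Binary.Pointwise.Extensional
  using (ext; extensional⇒inductive)
open import Data.Vec.Relation.Binary.Pointwise.Inductive as Pointwise
  using (Pointwise; []; _∷_)
open import Function.Base using (id; _∘_; flip)
open import Level using (0ℓ)
open import Relation.Binary.Construct.Flip.EqAndOrd as Flip using ()
open import Relation.Binary.Core using (Rel)
open import Relation.Binary.Definitions using (Monotonic₁)
open import Relation.Binary.PropositionalEquality
  using (_≡_; refl; sym; trans; cong; cong₂; subst)
open import Relation.Binary.Structures using (IsPreorder)
open import Relation.Nullary.Negation using (contradiction)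

updateWord-++ : ∀ {n} (f : Network n) v w x →
                updateWord f (v ++ w) x ≡ updateWord f w (updateWord f v x)
updateWord-++ f v w x = foldl-++ (λ y i → update f i y) x v w

updateWord-fixed : ∀ {n} (f : Network n) w {x} →
                   IsFixedPoint f x → updateWord f w x ≡ x
updateWord-fixed f []      fx≡x = refl
updateWord-fixed f (i ∷ w) {x} fx≡x = trans
  (cong (updateWord f w)
    (trans (cong (λ y → x [ i ]≔ lookup y i) fx≡x) ([]≔-lookup x i)))
  (updateWord-fixed f w fx≡x)

sweeps : (n k : ℕ) → Word n
sweeps n k = concat (replicate k (allFin n))

length-sweeps : ∀ n k → length (sweeps n k) ≡ k * n
length-sweeps n zero    = refl
length-sweeps n (suc k) = trans (length-++ (allFin n))
  (cong₂ _+_ (length-tabulate {n = n} id) (length-sweeps n k))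

-- Instantiated below with both the usual order on Bool and its converse, so
-- that increasing and decreasing trajectories are treated at once.
module Ascent
  (_≼_ : Rel Bool 0ℓ) (≼-isPreorder : IsPreorder _≡_ _≼_)
  (height : Bool → ℕ) (height≤1 : ∀ b → height b ≤ 1)
  (≼⇒≡⊎< : ∀ {a b} → a ≼ b → a ≡ b ⊎ height a < height b)
  where

  private
    module ≼ = IsPreorder ≼-isPreorder

  _⊑_ : ∀ {n} → Rel (Config n) 0ℓ
  _⊑_ = Pointwise _≼_

  ⊑-refl : ∀ {n} {x : Config n} → x ⊑ x
  ⊑-refl = Pointwise.refl ≼.refl

  ⊑-trans : ∀ {n} {x y z : Config n} → x ⊑ y → y ⊑ z → x ⊑ z
  ⊑-trans = Pointwise.trans ≼.trans

  heightᶜ : ∀ {n} → Config n → ℕ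
  heightᶜ []      = 0
  heightᶜ (b ∷ x) = height b + heightᶜ x

  heightᶜ≤n : ∀ {n} (x : Config n) → heightᶜ x ≤ n
  heightᶜ≤n []      = z≤n
  heightᶜ≤n (b ∷ x) = ℕ.+-mono-≤ (height≤1 b) (heightᶜ≤n x)

  -- Applied to `x ⊑ f x`, this separates a fixed point from strict progress.
  ⊑⇒≡⊎< : ∀ {n} {x y : Config n} → x ⊑ y → x ≡ y ⊎ heightᶜ x < heightᶜ y
  ⊑⇒≡⊎< [] = inj₁ refl
  ⊑⇒≡⊎< (a≼b ∷ x⊑y) with ≼⇒≡⊎< a≼b | ⊑⇒≡⊎< x⊑y
  ... | inj₁ refl | inj₁ refl = inj₁ refl
  ... | inj₁ refl | inj₂ x<y  = inj₂ (ℕ.+-monoʳ-< _ x<y)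
  ... | inj₂ a<b  | inj₁ refl = inj₂ (ℕ.+-monoˡ-< _ a<b)
  ... | inj₂ a<b  | inj₂ x<y  = inj₂ (ℕ.+-mono-< a<b x<y)

  heightᶜ-mono : ∀ {n} {x y : Config n} → x ⊑ y → heightᶜ x ≤ heightᶜ y
  heightᶜ-mono x⊑y with ⊑⇒≡⊎< x⊑y
  ... | inj₁ refl = ℕ.≤-refl
  ... | inj₂ x<y  = ℕ.<⇒≤ x<y

  []≔-lower : ∀ {n} {x y : Config n} → x ⊑ y → ∀ i → x ⊑ (x [ i ]≔ lookup y i)
  []≔-lower (a≼b ∷ _)   zero    = a≼b ∷ ⊑-refl
  []≔-lower (_   ∷ x⊑y) (suc i) = ≼.refl ∷ []≔-lower x⊑y i

  []≔-upper : ∀ {n} {x y : Config n} → x ⊑ y → ∀ i → (x [ i ]≔ lookup y i) ⊑ y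
  []≔-upper (_   ∷ x⊑y) zero    = ≼.refl ∷ x⊑y
  []≔-upper (a≼b ∷ x⊑y) (suc i) = a≼b ∷ []≔-upper x⊑y i

  module _ {n} (f : Network n) (mono : Monotonic₁ _⊑_ _⊑_ f) where

    -- With `x'` the updated configuration, `x ⊑ x' ⊑ f x`, and monotonicity gives `f x ⊑ f x'`.
    update-ascending : ∀ i {x} → x ⊑ f x → update f i x ⊑ f (update f i x)
    update-ascending i x⊑fx =
      ⊑-trans ([]≔-upper x⊑fx i) (mono ([]≔-lower x⊑fx i))

    updateWord-ascending : ∀ w {x} → x ⊑ f x →
                           updateWord f w x ⊑ f (updateWord f w x)
    updateWord-ascending []      x⊑fx = x⊑fx
    updateWord-ascending (i ∷ w) x⊑fx =
      updateWord-ascending w (update-ascending i x⊑fx)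

    updateWord-inflationary : ∀ w {x} → x ⊑ f x → x ⊑ updateWord f w x
    updateWord-inflationary []      x⊑fx = ⊑-refl
    updateWord-inflationary (i ∷ w) x⊑fx = ⊑-trans ([]≔-lower x⊑fx i)
      (updateWord-inflationary w (update-ascending i x⊑fx))

    -- Updates made before an occurrence of `i` can only raise the image under `f`, so the value
    -- written at `i` is at least that of `f x`; later updates never lower it.
    lookup-updateWord : ∀ {i w x} → x ⊑ f x → i ∈ w →
                        lookup (f x) i ≼ lookup (updateWord f w x) i
    lookup-updateWord {i} {_ ∷ w} {x} x⊑fx (here refl) =
      subst (_≼ lookup (updateWord f w (update f i x)) i)
        (lookup∘update i x _)
        (Pointwise.lookup
          (updateWord-inflationary w (update-ascending i x⊑fx)) i)
    lookup-updateWord {i} {j ∷ w} x⊑fx (there i∈w) = ≼.trans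
      (Pointwise.lookup (mono ([]≔-lower x⊑fx j)) i)
      (lookup-updateWord (update-ascending j x⊑fx) i∈w)

    sweep-dominates : ∀ {x} → x ⊑ f x → f x ⊑ updateWord f (allFin n) x
    sweep-dominates x⊑fx = extensional⇒inductive
      (ext λ i → lookup-updateWord x⊑fx (∈-allFin i))

    -- Height is a potential bounded by `n`. Unless `x` is already fixed, `f x` is strictly higher
    -- and one sweep climbs at least that far, so the invariant survives with one sweep fewer. With
    -- no sweeps left it would put the height above `n`.
    sweeps-fix-from : ∀ k {x} → x ⊑ f x → n < heightᶜ x + k →
                      IsFixedPoint f (updateWord f (sweeps n k) x)
    sweeps-fix-from zero {x} x⊑fx n<h = contradiction
      (ℕ.≤-trans n<h (ℕ.≤-reflexive (ℕ.+-identityʳ _)))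
      (ℕ.≤⇒≯ (heightᶜ≤n x))
    sweeps-fix-from (suc k) {x} x⊑fx n<h
      rewrite updateWord-++ f (allFin n) (sweeps n k) x
      with ⊑⇒≡⊎< x⊑fx
    ... | inj₁ x≡fx
      rewrite updateWord-fixed f (allFin n) (sym x≡fx)
            | updateWord-fixed f (sweeps n k) (sym x≡fx) = sym x≡fx
    ... | inj₂ x<fx = sweeps-fix-from k
      (updateWord-ascending (allFin n) x⊑fx)
      (begin-strict
        n                                         <⟨ n<h ⟩
        heightᶜ x + suc k                         ≡⟨ ℕ.+-suc _ k ⟩
        suc (heightᶜ x) + k                       ≤⟨ ℕ.+-monoˡ-≤ k x<fx ⟩
        heightᶜ (f x) + k                         ≤⟨ ℕ.+-monoˡ-≤ k
                                                       (heightᶜ-mono (sweep-dominates x⊑fx)) ⟩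
        heightᶜ (updateWord f (allFin n) x) + k   ∎)
      where open ≤-Reasoning

    sweeps-fix : ∀ {x} → x ⊑ f x →
                 IsFixedPoint f (updateWord f (sweeps n (suc n)) x)
    -- One sweep more than the number of components, so that the strict bound holds even from height
    -- 0.
    sweeps-fix {x} x⊑fx = sweeps-fix-from (suc n) x⊑fx (ℕ.m≤n+m (suc n) (heightᶜ x))

bit : Bool → ℕ
bit false = 0
bit true  = 1

bit≤1 : ∀ b → bit b ≤ 1
bit≤1 false = z≤n
bit≤1 true  = ℕ.≤-refl

≤⇒≡⊎bit< : ∀ {a b} → a Bool.≤ b → a ≡ b ⊎ bit a < bit b
≤⇒≡⊎bit< f≤t = inj₂ ℕ.≤-refl
≤⇒≡⊎bit< b≤b = inj₁ refl

≥⇒≡⊎bit∘not< : ∀ {a b} → b Bool.≤ a → a ≡ b ⊎ bit (not a) < bit (not b)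
≥⇒≡⊎bit∘not< f≤t = inj₂ ℕ.≤-refl
≥⇒≡⊎bit∘not< b≤b = inj₁ refl

module Up = Ascent Bool._≤_ ≤-isPreorder bit bit≤1 ≤⇒≡⊎bit<

-- Under the converse order the height counts the components equal to `false`.
module Down = Ascent (flip Bool._≤_) (Flip.isPreorder ≤-isPreorder)
  (bit ∘ not) (bit≤1 ∘ not) ≥⇒≡⊎bit∘not<

-- `Pointwise` of a flipped relation is not definitionally the flip of `Pointwise`, hence the
-- conversions.
≤ᶜ⇒⊒ : ∀ {n} {x y : Config n} → x ≤ᶜ y → y Down.⊑ x
≤ᶜ⇒⊒ = Pointwise.sym id

⊒⇒≤ᶜ : ∀ {n} {x y : Config n} → y Down.⊑ x → x ≤ᶜ y
⊒⇒≤ᶜ = Pointwise.sym id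

sweeps-fix-comparable : ∀ {n} (f : Network n) → Monotone f → ∀ {x} →
                        x ≤ᶜ f x ⊎ f x ≤ᶜ x →
                        IsFixedPoint f (updateWord f (sweeps n (suc n)) x)
sweeps-fix-comparable f mono (inj₁ x≤fx) = Up.sweeps-fix f mono x≤fx
sweeps-fix-comparable f mono (inj₂ fx≤x) =
  Down.sweeps-fix f (≤ᶜ⇒⊒ ∘ mono ∘ ⊒⇒≤ᶜ) (≤ᶜ⇒⊒ fx≤x)

-- The network seen by words that avoid the letter `zero`, the first component staying frozen at
-- `b`.
restrict : ∀ {n} → Network (suc n) → Bool → Network n
restrict f b x = Vec.tail (f (b ∷ x))

tail-mono : ∀ {n} {x y : Config (suc n)} → x ≤ᶜ y → Vec.tail x ≤ᶜ Vec.tail y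
tail-mono (_ ∷ x≤y) = x≤y

restrict-monotone : ∀ {n} (f : Network (suc n)) → Monotone f →
                    ∀ b → Monotone (restrict f b)
restrict-monotone f mono b x≤y = tail-mono (mono (b≤b ∷ x≤y))

update-suc : ∀ {n} (f : Network (suc n)) i b x →
             update f (suc i) (b ∷ x) ≡ b ∷ update (restrict f b) i x
-- Exposing the image as a cons lets `lookup` at `suc i` and `Vec.tail` reduce.
update-suc f i b x with f (b ∷ x)
... | _ ∷ _ = refl

updateWord-map-suc : ∀ {n} (f : Network (suc n)) w b x →
                     updateWord f (map suc w) (b ∷ x) ≡
                     b ∷ updateWord (restrict f b) w x
updateWord-map-suc f []      b x = refl
updateWord-map-suc f (i ∷ w) b x = trans
  (cong (updateWord f (map suc w)) (update-suc f i b x))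
  (updateWord-map-suc f w b (update (restrict f b) i x))

-- Only the heads can differ, and the order on `Bool` is total.
tail≡⇒comparable : ∀ {n} b (x : Config n) y → Vec.tail y ≡ x →
                   (b ∷ x) ≤ᶜ y ⊎ y ≤ᶜ (b ∷ x)
tail≡⇒comparable b x (c ∷ .x) refl =
  Sum.map (_∷ Up.⊑-refl) (_∷ Up.⊑-refl) (≤-total b c)

fixingWord : (n : ℕ) → Word n
fixingWord zero    = []
fixingWord (suc n) = map suc (fixingWord n) ++ sweeps (suc n) (suc (suc n))

-- The shorter word fixes every monotone network on `n` components, so it serves both restrictions
-- of `f`, whichever `b` the start has.
fixingWord-fixes : ∀ n (f : Network n) → Monotone f → Fixes (fixingWord n) f
fixingWord-fixes zero    f mono [] with f []
... | [] = refl
fixingWord-fixes (suc n) f mono (b ∷ x)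
  rewrite updateWord-++ f (map suc (fixingWord n)) (sweeps (suc n) (suc (suc n))) (b ∷ x)
        | updateWord-map-suc f (fixingWord n) b x
  -- That `y` is fixed by `restrict f b` unfolds to `Vec.tail (f (b ∷ y)) ≡ y`.
  = sweeps-fix-comparable f mono (tail≡⇒comparable b y (f (b ∷ y))
      (fixingWord-fixes n (restrict f b) (restrict-monotone f mono b) x))
  where y = updateWord (restrict f b) (fixingWord n) x

-- Cubes appear as the products to which `_^ 3` reduces; the last summand is the slack in the length
-- recurrence. The factor 2 is tight for this word at one component, where two sweeps have length 2.
cube-step : ∀ n → 2 * (suc n * (suc n * (suc n * 1))) ≡
            (2 * (n * (n * (n * 1))) + suc (suc n) * suc n) + (5 * (n * n) + 3 * n)
cube-step = solve-∀

length-fixingWord : ∀ n → length (fixingWord n) ≤ 2 * n ^ 3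
length-fixingWord zero    = z≤n
length-fixingWord (suc n) = begin
  length (map suc w ++ s)                ≡⟨ length-++ (map suc w) ⟩
  length (map suc w) + length s          ≡⟨ cong₂ _+_ (length-map suc w)
                                              (length-sweeps (suc n) (suc (suc n))) ⟩
  length w + suc (suc n) * suc n         ≤⟨ ℕ.+-monoˡ-≤ _ (length-fixingWord n) ⟩
  2 * n ^ 3 + suc (suc n) * suc n        ≤⟨ ℕ.m≤m+n _ (5 * (n * n) + 3 * n) ⟩
  (2 * n ^ 3 + suc (suc n) * suc n) + (5 * (n * n) + 3 * n) ≡⟨ cube-step n ⟨
  2 * suc n ^ 3                          ∎
  where
  open ≤-Reasoning
  w = fixingWord n
  s = sweeps (suc n) (suc (suc n))

theorem4 : Σ[ C ∈ ℕ ] (0 < C × ((n : ℕ) → 0 < n →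
    Σ[ w ∈ Word n ] (length w ≤ C * n ^ 3 ×
    ((f : Network n) → Monotone f → Fixes w f))))
theorem4 = 2 , s≤s z≤n , λ n _ →
  fixingWord n , length-fixingWord n , fixingWord-fixes n
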